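{- Let $G$ be a permutation graph. Then either $\tau(G)\le 4$, or $G$ is (isomorphic to) the Petersen graph.
   Context: A cubic graph $G$ is a permutation graph if it has a $2$-factor which is the union of two chordless cycles $C$ and $C'$. For a bridgeless cubic graph $G$, the perfect matching index $\tau(G)$ is the minimum number of perfect matchings of $G$ whose union is $E(G)$. -}

module Defs where

open import Data.Nat using (ℕ; zero; suc; _≤_; _≡ᵇ_)
open import Data.Nat.DivMod using (_%_; m%n<n)
open import Data.Bool using (Bool; true; false; _∧_; _∨_)
open import Data.Fin using (Fin; toℕ; fromℕ<)
open import Data.List using (List; []; _∷_; length; filterᵇ; allFin)
open import Data.Bool.ListAction using (any)
open import Data.Empty using (⊥)
open import Data.List.Relation.Unary.Any using (Any)
open import Data.Product using (Σ; ∃; _×_; _,_)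
open import Data.Sum using (_⊎_)
open import Function.Bundles using (_↔_; Inverse)
open import Relation.Binary.PropositionalEquality using (_≡_)
open import Function.Definitions using (Injective)

record Graph : Set where
  field
    n     : ℕ
    adj   : Fin n → Fin n → Bool
    sym   : ∀ u v → adj u v ≡ adj v u
    irref : ∀ v → adj v v ≡ false
open Graph public

degree : (G : Graph) → Fin (n G) → ℕ
degree G v = length (filterᵇ (adj G v) (allFin (n G)))

Cubic : Graph → Set
Cubic G = ∀ v → degree G v ≡ 3

csuc : ∀ {k} → Fin k → Fin k
csuc {suc m} i = fromℕ< (m%n<n (suc (toℕ i)) (suc m))

record Cycle (G : Graph) : Set where
  field
    len    : ℕ
    len≥3  : 3 ≤ len
    vert   : Fin len → Fin (n G)
    inj    : Injective _≡_ _≡_ vert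
    edges  : ∀ i → adj G (vert i) (vert (csuc i)) ≡ true
open Cycle public

Chordless : {G : Graph} → Cycle G → Set
Chordless {G} C = ∀ i j → adj G (vert C i) (vert C j) ≡ true →
              (j ≡ csuc i) ⊎ (i ≡ csuc j)

TwoFactorOf : {G : Graph} → Cycle G → Cycle G → Set
TwoFactorOf {G} C C' =
  (∀ v → (∃ λ i → vert C i ≡ v) ⊎ (∃ λ j → vert C' j ≡ v)) ×
  (∀ i j → vert C i ≡ vert C' j → ⊥)

PermutationGraph : Graph → Set
PermutationGraph G =
  Cubic G × Σ (Cycle G) λ C → Σ (Cycle G) λ C' →
    Chordless C × Chordless C' × TwoFactorOf C C'

record PerfectMatching (G : Graph) : Set where
  field
    inM    : Fin (n G) → Fin (n G) → Bool
    inM-sym : ∀ u v → inM u v ≡ inM v u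
    inM⊆E  : ∀ u v → inM u v ≡ true → adj G u v ≡ true
    unique : ∀ v → ∃ λ w → (inM v w ≡ true) × (∀ w' → inM v w' ≡ true → w' ≡ w)
open PerfectMatching public

-- τ(G) ≤ k : E(G) is the union of (at most) k perfect matchings
-- (repetitions allowed, so "at most k" = "exactly k" in a list of length k).
τ≤ : Graph → ℕ → Set
τ≤ G k = Σ (List (PerfectMatching G)) λ Ms →
  (length Ms ≤ k) ×
  (∀ u v → adj G u v ≡ true →
     Any (λ M → inM M u v ≡ true) Ms)

-- The Petersen graph: outer 5-cycle 0..4, inner pentagram 5..9, spokes i–i+5.
petEdges : List (ℕ × ℕ)
petEdges = (0 , 1) ∷ (1 , 2) ∷ (2 , 3) ∷ (3 , 4) ∷ (4 , 0)
         ∷ (5 , 7) ∷ (7 , 9) ∷ (9 , 6) ∷ (6 , 8) ∷ (8 , 5)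
         ∷ (0 , 5) ∷ (1 , 6) ∷ (2 , 7) ∷ (3 , 8) ∷ (4 , 9) ∷ []

petAdjℕ : ℕ → ℕ → Bool
petAdjℕ a b = any (λ { (x , y) → ((x ≡ᵇ a) ∧ (y ≡ᵇ b)) ∨ ((x ≡ᵇ b) ∧ (y ≡ᵇ a)) }) petEdges

petAdj : Fin 10 → Fin 10 → Bool
petAdj u v = petAdjℕ (toℕ u) (toℕ v)

IsoPetersen : Graph → Set
IsoPetersen G = Σ (Fin (n G) ↔ Fin 10) λ φ →
  ∀ u v → adj G u v ≡ petAdj (Inverse.to φ u) (Inverse.to φ v)

{-# OPTIONS --safe #-}
module Submission where

-- Let k be the length of both cycles; if k is even, the spokes and two alternating matchings cover. If k is odd,
-- put x ⟶ y when the clockwise distance from x to y on a cycle is odd. This is a locally transitive tournament.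
-- For each spoke x there is one perfect matching M x containing x and no other spoke, and it contains the edge
-- {i , csuc i} exactly when x ⟶ i. No vertex dominates or is dominated by a ⟶-cyclic triple, so if {x , y , z} is
-- cyclic on both cycles, then the spokes together with M x, M y, M z cover all edges.
-- If no triple is cyclic on both cycles, let v₀, v₁, … be the first cycle and ⇒ the tournament of the second one.
-- Up to reversal vₙ ⇒ vₙ₊₁ and vₙ ⇒ vₙ₊₂ for all n. The first i with vᵢ₊₂ ⇒ v₀ satisfies vᵢ₊₃ ⇒ vᵢ; this relation
-- propagates along the cycle and is contradictory for k ≥ 7. For k = 5 the relations vₙ ⇒ vₙ₊₁ and vₙ ⇒ vₙ₊₂
-- determine ⇒, and the graph is the Petersen graph.

open import Defs renaming (sym to adj-sym)
open import Data.Bool using (Bool; true; false; not; T?; _≟_)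
open import Data.Bool.Properties using (¬-not; not-¬; not-injective; not-involutive; T-≡; ⇔→≡)
open import Data.Empty using (⊥-elim)
open import Data.Fin using (Fin; zero; suc; toℕ; fromℕ; inject₁; _↑ˡ_; _↑ʳ_; splitAt; join)
open import Data.Fin.Properties
  using (toℕ-injective; toℕ<n; toℕ-fromℕ<; toℕ-fromℕ; toℕ-inject₁; all?; any?; join-splitAt; splitAt-join;
         cantor-schröder-bernstein)
  renaming (_≟_ to _≟ᶠ_)
open import Data.List using (List; []; _∷_; length; filter; allFin; lookup; map)
open import Data.List.Membership.Propositional using (_∈_)
open import Data.List.Membership.Propositional.Properties using (∈-filter⁺; ∈-filter⁻; ∈-allFin; ∈-lookup)
open import Data.List.Properties using (length-map)
import Data.List.Relation.Unary.All as All
open import Data.List.Relation.Unary.AllPairs using (_∷_)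
open import Data.List.Relation.Unary.Any as Any using (Any; here; there; index)
open import Data.List.Relation.Unary.Any.Properties using (lookup-index; map⁺)
open import Data.List.Relation.Unary.Unique.Propositional using (Unique)
open import Data.List.Relation.Unary.Unique.Propositional.Properties using (filter⁺; allFin⁺)
open import Data.Nat using (ℕ; zero; suc; _+_; _*_; _≤_; _<_; z≤n; s≤s)
open import Data.Nat.DivMod using (_%_; m<n⇒m%n≡m; n%n≡0; m%n<n)
import Data.Nat.Properties as ℕ
open import Data.Product using (∃; _×_; _,_; proj₁; proj₂)
open import Data.Sum as Sum using (_⊎_; inj₁; inj₂; [_,_]′; swap; map₂)
open import Function using (flip; _on_; _∘_; Equivalence; mk⇔; mk↔ₛ′)
open import Function.Definitions using (Injective; StrictlySurjective)
open import Level using (0ℓ)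
open import Relation.Binary using (Rel; Decidable; tri<; tri≈; tri>)
open import Relation.Binary.PropositionalEquality
  using (_≡_; _≢_; refl; sym; trans; cong; cong₂; subst; subst₂)
open import Relation.Nullary using (¬_; Dec; yes; no; ¬?; _→-dec_; _×-dec_; _⊎-dec_)
open import Relation.Nullary.Decidable using (from-yes; does; dec-true; does-⇔)

-- Locally transitive tournaments

Cyclic : {V : Set} → Rel V 0ℓ → V → V → V → Set
Cyclic _⇒_ a b c = a ⇒ b × b ⇒ c × c ⇒ a

-- `noSource` and `noSink` say that the out- and in-neighbourhoods of a vertex contain no cyclic
-- triple, hence are transitive. `triangle` adds that every arc lies in a cyclic triple.
record LocallyTransitive {V : Set} (_⇒_ : Rel V 0ℓ) : Set where
  field
    asym     : ∀ {a b} → a ⇒ b → ¬ b ⇒ a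
    total    : ∀ {a b} → a ≢ b → a ⇒ b ⊎ b ⇒ a
    noSource : ∀ {a b c d} → Cyclic _⇒_ a b c → d ⇒ a → d ⇒ b → ¬ d ⇒ c
    noSink   : ∀ {a b c d} → Cyclic _⇒_ a b c → a ⇒ d → b ⇒ d → ¬ c ⇒ d
    triangle : ∀ {a b} → a ⇒ b → ∃ λ c → Cyclic _⇒_ a b c

  ⇒-≢ : ∀ {a b} → a ⇒ b → a ≢ b
  ⇒-≢ a⇒a refl = asym a⇒a a⇒a

open LocallyTransitive

opposite : {V : Set} {_⇒_ : Rel V 0ℓ} → LocallyTransitive _⇒_ → LocallyTransitive (flip _⇒_)
opposite L = record
  { asym     = λ p → asym L p
  ; total    = λ a≢b → total L (a≢b ∘ sym)
  ; noSource = λ (p , q , r) x y z → noSink L (p , r , q) y x z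
  ; noSink   = λ (p , q , r) x y z → noSource L (p , r , q) y x z
  ; triangle = λ p → let (c , q , r , s) = triangle L p in c , q , s , r
  }

-- By symmetry let `a ⇒ c`. The arc `b ⇒ a` closes to a cyclic triple with some `z`; since `z ⇒ c`
-- would make `c` a sink of that triple, `c ⇒ z`.
sharedApex : {V : Set} {_⇒_ : Rel V 0ℓ} → LocallyTransitive _⇒_ →
             ∀ {a b c} → b ⇒ a → b ⇒ c → a ≢ c → ∃ λ z → a ⇒ z × c ⇒ z × z ⇒ b
sharedApex {_⇒_ = _⇒_} L b⇒a b⇒c a≢c = [ (λ a⇒c → nested b⇒a b⇒c a⇒c) , swapped ]′ (total L a≢c)
  where
  nested : ∀ {a b c} → b ⇒ a → b ⇒ c → a ⇒ c → ∃ λ z → a ⇒ z × c ⇒ z × z ⇒ b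
  nested b⇒a b⇒c a⇒c with triangle L b⇒a
  ... | z , cyc@(_ , a⇒z , z⇒b) with total L (λ c≡z → asym L b⇒c (subst (_⇒ _) (sym c≡z) z⇒b))
  ...   | inj₁ c⇒z = z , a⇒z , c⇒z , z⇒b
  ...   | inj₂ z⇒c = ⊥-elim (noSink L cyc b⇒c a⇒c z⇒c)
  swapped : _ → _
  swapped c⇒a = let (z , c⇒z , a⇒z , z⇒b) = nested b⇒c b⇒a c⇒a in z , a⇒z , c⇒z , z⇒b

pullback : {U V : Set} {_⇒_ : Rel V 0ℓ} (q : U → V) → Injective _≡_ _≡_ q →
           StrictlySurjective _≡_ q → LocallyTransitive _⇒_ → LocallyTransitive (_⇒_ on q)
pullback {_⇒_ = _⇒_} q q-inj q-surj L = record
  { asym     = asym L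
  ; total    = λ a≢b → total L (a≢b ∘ q-inj)
  ; noSource = noSource L
  ; noSink   = noSink L
  ; triangle = λ {a} {b} p → let (c , r) = triangle L p ; (c′ , e) = q-surj c
                             in c′ , subst (Cyclic _⇒_ (q a) (q b)) (sym e) r
  }

-- Parity and the tournament of odd clockwise distances

even : ℕ → Bool
even zero    = true
even (suc n) = not (even n)

even-*2 : ∀ n → even (n * 2) ≡ true
even-*2 zero    = refl
even-*2 (suc n) rewrite even-*2 n = refl

csuc-cases : ∀ {m} (i : Fin (suc m)) →
             (toℕ (csuc i) ≡ suc (toℕ i) × toℕ i < m) ⊎ (csuc i ≡ zero × toℕ i ≡ m)
csuc-cases {m} i with ℕ.m≤n⇒m<n∨m≡n (ℕ.≤-pred (toℕ<n i))
... | inj₁ i<m = inj₁ (trans (toℕ-fromℕ< _) (m<n⇒m%n≡m (s≤s i<m)) , i<m)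
... | inj₂ i≡m  = inj₂ (toℕ-injective (trans (toℕ-fromℕ< (m%n<n (suc (toℕ i)) (suc m))) wrap) , i≡m)
  where
  wrap : suc (toℕ i) % suc m ≡ 0
  wrap = trans (cong (λ j → suc j % suc m) i≡m) (n%n≡0 (suc m))

csuc-injective : ∀ {k} → Injective _≡_ _≡_ (csuc {k})
csuc-injective {suc m} {i} {j} e with csuc-cases i | csuc-cases j
... | inj₁ (p , _) | inj₁ (q , _) = toℕ-injective (ℕ.suc-injective (trans (sym p) (trans (cong toℕ e) q)))
... | inj₁ (p , _) | inj₂ (q , _) with () ← trans (sym p) (cong toℕ (trans e q))
... | inj₂ (p , _) | inj₁ (q , _) with () ← trans (sym q) (cong toℕ (trans (sym e) p))
... | inj₂ (_ , p) | inj₂ (_ , q) = toℕ-injective (trans p (sym q))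

-- i ⟶ j says that the clockwise distance from i to j on a cycle of odd length is odd.
data _⟶_ {k : ℕ} (i j : Fin k) : Set where
  up   : toℕ i < toℕ j → even (toℕ j) ≡ not (even (toℕ i)) → i ⟶ j
  down : toℕ j < toℕ i → even (toℕ j) ≡ even (toℕ i) → i ⟶ j

⟶-asym : ∀ {k} {i j : Fin k} → i ⟶ j → ¬ j ⟶ i
⟶-asym (up p _)   (up q _)   = ℕ.<-asym p q
⟶-asym (up _ p)   (down _ q) = not-¬ (sym q) p
⟶-asym (down _ p) (up _ q)   = not-¬ (sym p) q
⟶-asym (down p _) (down q _) = ℕ.<-asym p q

⟶-total : ∀ {k} {i j : Fin k} → i ≢ j → i ⟶ j ⊎ j ⟶ i
⟶-total {_} {i} {j} i≢j with ℕ.<-cmp (toℕ i) (toℕ j) | even (toℕ i) ≟ even (toℕ j)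
... | tri≈ _ e _ | _     = ⊥-elim (i≢j (toℕ-injective e))
... | tri< p _ _ | yes e = inj₂ (down p e)
... | tri< p _ _ | no ne = inj₁ (up p (¬-not (ne ∘ sym)))
... | tri> _ _ p | yes e = inj₁ (down p (sym e))
... | tri> _ _ p | no ne = inj₂ (up p (¬-not ne))

⟶-up : ∀ {k} {i j : Fin k} → i ⟶ j → toℕ i < toℕ j → even (toℕ j) ≡ not (even (toℕ i))
⟶-up (up _ e)   _ = e
⟶-up (down p _) q = ⊥-elim (ℕ.<-asym p q)

⟶-down : ∀ {k} {i j : Fin k} → i ⟶ j → toℕ j < toℕ i → even (toℕ j) ≡ even (toℕ i)
⟶-down (up p _)   q = ⊥-elim (ℕ.<-asym p q)
⟶-down (down _ e) _ = e

record Alternating {k} (a b c : Fin k) : Set where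
  constructor alternating
  field
    a<b   : toℕ a < toℕ b
    b<c   : toℕ b < toℕ c
    flipᵇ : even (toℕ b) ≡ not (even (toℕ a))
    flipᶜ : even (toℕ c) ≡ even (toℕ a)

-- An `up` arc changes parity and a `down` arc keeps it, so a closed triple has an even number of
-- `up` arcs. Three `down` arcs would decrease the index all the way round, so there are two `up`
-- arcs and one `down` arc; the triple is read from its smallest index.
⟶-alternating : ∀ {k} {a b c : Fin k} → Cyclic _⟶_ a b c →
                Alternating a b c ⊎ Alternating b c a ⊎ Alternating c a b
⟶-alternating {a = a} {b} {c} = λ where
  (up p e , up q f , up r g)       → ⊥-elim (ℕ.<-asym p (ℕ.<-trans q r))
  (up p e , up q f , down r g)     → inj₁ (alternating p q e (sym g))
  (up p e , down q f , up r g)     → inj₂ (inj₂ (alternating r p g (sym f)))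
  (down p e , up q f , up r g)     → inj₂ (inj₁ (alternating q r f (sym e)))
  (up p e , down q f , down r g)   → ⊥-elim (not-¬ (sym (trans g f)) e)
  (down p e , up q f , down r g)   → ⊥-elim (not-¬ (sym (trans e g)) f)
  (down p e , down q f , up r g)   → ⊥-elim (not-¬ (sym (trans f e)) g)
  (down p e , down q f , down r g) → ⊥-elim (ℕ.<-asym p (ℕ.<-trans r q))

-- Arcs from `d` lead to opposite parity above `d` and to equal parity below. So `a` and `b` get
-- equal parity if `d` lies below `a` or above `c`, and `a` and `c` get opposite parity if `d` lies
-- between them.
alternating-noSource : ∀ {k} {a b c d : Fin k} → Alternating a b c → d ⟶ a → d ⟶ b → ¬ d ⟶ c
alternating-noSource (alternating p q e f) (up x u) y z =
  not-¬ (trans (⟶-up y (ℕ.<-trans x p)) (sym u)) e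
alternating-noSource (alternating p q e f) (down x u) y (up z v) =
  not-¬ (sym (trans (sym u) (sym f))) v
alternating-noSource (alternating p q e f) (down x u) y (down z v) =
  not-¬ (trans (⟶-down y (ℕ.<-trans q z)) (sym u)) e

alternating-noSink : ∀ {k} {a b c d : Fin k} → Alternating a b c → a ⟶ d → b ⟶ d → ¬ c ⟶ d
alternating-noSink (alternating p q e f) (up x u) y (up z v) =
  not-¬ (trans u (sym e)) (⟶-up y (ℕ.<-trans q z))
alternating-noSink (alternating p q e f) (up x u) y (down z v) =
  not-¬ (trans v f) u
alternating-noSink (alternating p q e f) (down x u) y z =
  not-¬ (trans (sym (⟶-down y (ℕ.<-trans x p))) u) e

⟶-noSource : ∀ {k} {a b c d : Fin k} → Cyclic _⟶_ a b c → d ⟶ a → d ⟶ b → ¬ d ⟶ c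
⟶-noSource cyc x y z with ⟶-alternating cyc
... | inj₁ alt        = alternating-noSource alt x y z
... | inj₂ (inj₁ alt) = alternating-noSource alt y z x
... | inj₂ (inj₂ alt) = alternating-noSource alt z x y

⟶-noSink : ∀ {k} {a b c d : Fin k} → Cyclic _⟶_ a b c → a ⟶ d → b ⟶ d → ¬ c ⟶ d
⟶-noSink cyc x y z with ⟶-alternating cyc
... | inj₁ alt        = alternating-noSink alt x y z
... | inj₂ (inj₁ alt) = alternating-noSink alt y z x
... | inj₂ (inj₂ alt) = alternating-noSink alt z x y

-- Cycles of odd length

module OddCycle (h : ℕ) (h>0 : 0 < h) where

  k : ℕ
  k = suc (h * 2)

  ⟶-csuc : ∀ (i : Fin k) → i ⟶ csuc i
  ⟶-csuc i with csuc-cases i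
  ... | inj₁ (e , _) = up (subst (toℕ i <_) (sym e) ℕ.≤-refl) (cong even e)
  -- The step from the last index to zero is a `down` arc because both indices are even. Here the
  -- odd length enters.
  ... | inj₂ (e , i≡m) rewrite e = down (subst (0 <_) (sym i≡m) (ℕ.*-mono-< h>0 (s≤s (z≤n {1}))))
                                        (sym (trans (cong even i≡m) (even-*2 h)))

  last-even : ∀ {i : Fin k} → toℕ i ≡ h * 2 → even (toℕ i) ≡ true
  last-even i≡m = trans (cong even i≡m) (even-*2 h)

  nothing-above : ∀ {i j : Fin k} → toℕ i ≡ h * 2 → ¬ toℕ i < toℕ j
  nothing-above {j = j} i≡m i<j = ℕ.<⇒≱ i<j (subst (toℕ j ≤_) (sym i≡m) (ℕ.≤-pred (toℕ<n j)))

  -- An odd distance from `x` to `y` is not `k - 1`, so one more step reaches a vertex other than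
  -- `x` at even distance; the rest of the way round to `x` is then odd.
  ⟶-flip : ∀ {x y : Fin k} → x ⟶ y → csuc y ⟶ x
  ⟶-flip {x} {y} x⟶y with csuc-cases y
  ⟶-flip {x} {y} (up p f)   | inj₁ (e , _) =
    down (subst (toℕ x <_) (sym e) (ℕ.m<n⇒m<1+n p))
         (sym (trans (cong even e) (trans (cong not f) (not-involutive _))))
  ⟶-flip {x} {y} (down p f) | inj₁ (e , _) =
    up (ℕ.≤∧≢⇒< (subst (_≤ toℕ x) (sym e) p) (λ c≡x → not-¬ (sym f) (sym (cong even (trans (sym e) c≡x)))))
       (trans (sym f) (trans (sym (not-involutive _)) (cong not (sym (cong even e)))))
  ⟶-flip {x} {y} (up p f)   | inj₂ (e , y≡m) rewrite e = up (ℕ.n≢0⇒n>0 x≢0) (not-injective (trans (sym f) (last-even y≡m)))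
    where
    x≢0 : toℕ x ≢ 0
    x≢0 x≡0 = not-¬ (cong even x≡0) (trans (sym (not-involutive _)) (cong not (trans (sym f) (last-even y≡m))))
  ⟶-flip {x} {y} (down p f) | inj₂ (e , y≡m) = ⊥-elim (nothing-above y≡m p)

  -- The distance from `csuc y` to `x` is even, and nonzero by `csuc y ≢ x`, so the way from `x` to
  -- `csuc y` is odd.
  ⟶-flip⁻ : ∀ {x y : Fin k} → y ⟶ x → csuc y ≢ x → x ⟶ csuc y
  ⟶-flip⁻ {x} {y} y⟶x c≢x with csuc-cases y
  ⟶-flip⁻ {x} {y} (up p f)   c≢x | inj₁ (e , _) =
    down (ℕ.≤∧≢⇒< (subst (_≤ toℕ x) (sym e) p) (c≢x ∘ toℕ-injective)) (trans (cong even e) (sym f))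
  ⟶-flip⁻ {x} {y} (down p f) c≢x | inj₁ (e , _) =
    up (subst (toℕ x <_) (sym e) (ℕ.m<n⇒m<1+n p)) (trans (cong even e) (cong not (sym f)))
  ⟶-flip⁻ {x} {y} (up p f)   c≢x | inj₂ (e , y≡m) = ⊥-elim (nothing-above y≡m p)
  ⟶-flip⁻ {x} {y} (down p f) c≢x | inj₂ (e , y≡m) rewrite e =
    down (ℕ.n≢0⇒n>0 (λ x≡0 → c≢x (toℕ-injective (sym x≡0)))) (sym (trans f (last-even y≡m)))

  ⟶-triangle : ∀ {x y : Fin k} → x ⟶ y → ∃ λ z → Cyclic _⟶_ x y z
  ⟶-triangle {y = y} x⟶y = csuc y , x⟶y , ⟶-csuc y , ⟶-flip x⟶y

  ⟶-locallyTransitive : LocallyTransitive (_⟶_ {k})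
  ⟶-locallyTransitive = record
    { asym     = ⟶-asym
    ; total    = ⟶-total
    ; noSource = ⟶-noSource
    ; noSink   = ⟶-noSink
    ; triangle = ⟶-triangle
    }

  -- Indexing by all natural numbers, with period `k`, avoids reducing sums modulo `k`.
  vtx : ℕ → Fin k
  vtx zero    = zero
  vtx (suc i) = csuc (vtx i)

  toℕ-vtx : ∀ {i} → i < k → toℕ (vtx i) ≡ i
  toℕ-vtx {zero}  _ = refl
  toℕ-vtx {suc i} (s≤s i<m) with csuc-cases (vtx i) | toℕ-vtx {i} (ℕ.m<n⇒m<1+n i<m)
  ... | inj₁ (e , _) | ih = trans e (cong suc ih)
  ... | inj₂ (_ , e) | ih = ⊥-elim (ℕ.<⇒≢ i<m (trans (sym ih) e))

  vtx-toℕ : ∀ (x : Fin k) → vtx (toℕ x) ≡ x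
  vtx-toℕ x = toℕ-injective (toℕ-vtx (toℕ<n x))

  vtx-cancel : ∀ n {i j} → vtx (n + i) ≡ vtx (n + j) → vtx i ≡ vtx j
  vtx-cancel zero    e = e
  vtx-cancel (suc n) e = vtx-cancel n (csuc-injective e)

  vtx-cong : ∀ n {i j} → vtx i ≡ vtx j → vtx (n + i) ≡ vtx (n + j)
  vtx-cong zero    e = e
  vtx-cong (suc n) e = cong csuc (vtx-cong n e)

  vtx-period : ∀ n → vtx (k + n) ≡ vtx n
  vtx-period n =
    trans (cong vtx (ℕ.+-comm k n)) (trans (vtx-cong n {k} {0} vtx-k) (cong vtx (ℕ.+-identityʳ n)))
    where
    vtx-k : vtx k ≡ vtx 0
    vtx-k with csuc-cases (vtx (h * 2))
    ... | inj₁ (_ , p) = ⊥-elim (ℕ.<⇒≢ p (toℕ-vtx ℕ.≤-refl))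
    ... | inj₂ (e , _) = e

  vtx-≢ : ∀ n {i} → 0 < i → i < k → vtx (i + n) ≢ vtx n
  vtx-≢ n {i} 0<i i<k e = ℕ.<⇒≢ 0<i (trans (cong toℕ (sym vi≡v0)) (toℕ-vtx i<k))
    where
    vi≡v0 : vtx i ≡ vtx 0
    vi≡v0 = vtx-cancel n (trans (cong vtx (ℕ.+-comm n i)) (trans e (cong vtx (sym (ℕ.+-identityʳ n)))))

  -- Mutual induction: each further step of the second vertex changes the parity of the distance and
  -- so reverses the arc.
  odd-gap : ∀ {j} n → j < h → vtx n ⟶ vtx (suc (j * 2) + n)
  even-gap : ∀ {j} n → j < h → vtx (suc (suc (j * 2)) + n) ⟶ vtx n

  odd-gap {zero}  n _   = ⟶-csuc (vtx n)
  odd-gap {suc j} n j<h =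
    ⟶-flip⁻ (even-gap n (ℕ.<⇒≤ j<h)) (vtx-≢ n (s≤s z≤n) (s≤s (ℕ.≤-trans (ℕ.n≤1+n _) (ℕ.*-monoˡ-≤ 2 j<h))))

  even-gap n j<h = ⟶-flip (odd-gap n j<h)

  -- Tournaments without a common cyclic triple

  Disjoint : Rel (Fin k) 0ℓ → Set
  Disjoint _⇒_ = ∀ {a b c} → Cyclic _⟶_ a b c → ¬ Cyclic _⇒_ a b c

  -- Every z other than a, b = csuc a and c = csuc b forms a ⟶-cyclic triple with {a , b} or with {b , c}.
  csuc-not-source : ∀ {_⇒_} → LocallyTransitive _⇒_ → Disjoint _⇒_ → Disjoint (flip _⇒_) →
                    ∀ {a} → csuc a ⇒ a → ¬ csuc a ⇒ csuc (csuc a)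
  csuc-not-source B disj disjᵒ {a} b⇒a b⇒c
    with sharedApex B b⇒a b⇒c (⇒-≢ ⟶-locallyTransitive (⟶-flip (⟶-csuc a)) ∘ sym)
  ... | z , a⇒z , c⇒z , z⇒b with ⟶-total (⇒-≢ B z⇒b)
  ...   | inj₁ z⟶b = disj (⟶-csuc (csuc a) , ⟶-flip z⟶b , z⟶b) (b⇒c , c⇒z , z⇒b)
  ...   | inj₂ b⟶z with ⟶-total (⇒-≢ B a⇒z)
  ...     | inj₁ a⟶z = ⟶-asym b⟶z (⟶-flip⁻ a⟶z (⇒-≢ B z⇒b ∘ sym))
  ...     | inj₂ z⟶a = disjᵒ (⟶-csuc a , b⟶z , z⟶a) (b⇒a , z⇒b , a⇒z)

  -- `start` fixes one of two directions; the other is obtained by applying the module to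
  -- `flip _⇒_`, with `disj` and `disjᵒ` exchanged.
  module Oriented {_⇒_ : Rel (Fin k) 0ℓ} (B : LocallyTransitive _⇒_)
    (disj : Disjoint _⇒_) (disjᵒ : Disjoint (flip _⇒_)) (start : vtx 0 ⇒ vtx 1) where

    order : ∀ n {i} → 0 < i → i < k → vtx n ⇒ vtx (i + n) ⊎ vtx (i + n) ⇒ vtx n
    order n 0<i i<k = total B (vtx-≢ n 0<i i<k ∘ sym)

    order-odd : ∀ n {j} → j < h → vtx n ⇒ vtx (suc (j * 2) + n) ⊎ vtx (suc (j * 2) + n) ⇒ vtx n
    order-odd n {j} j<h = order n {suc (j * 2)} (s≤s z≤n) (ℕ.<⇒≤ (s≤s (ℕ.*-monoˡ-≤ 2 j<h)))

    order-even : ∀ n {j} → j < h → vtx n ⇒ vtx (suc j * 2 + n) ⊎ vtx (suc j * 2 + n) ⇒ vtx n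
    order-even n {j} j<h = order n {suc j * 2} (s≤s z≤n) (s≤s (ℕ.*-monoˡ-≤ 2 j<h))

    -- At the first reversal, `vtx (suc n)` would be dominated by both its neighbours on the cycle,
    -- which `csuc-not-source` excludes in the opposite tournament.
    step₁ : ∀ n → vtx n ⇒ vtx (1 + n)
    step₁ zero    = start
    step₁ (suc n) with order-odd (suc n) h>0
    ... | inj₁ p = p
    ... | inj₂ p = ⊥-elim (csuc-not-source (opposite B) disjᵒ disj {vtx n} (step₁ n) p)

    -- The opposite arc would make three consecutive vertices a cyclic triple of both tournaments.
    step₂ : ∀ n → vtx n ⇒ vtx (2 + n)
    step₂ n with order-even n h>0
    ... | inj₁ p = p
    ... | inj₂ p = ⊥-elim (disj (⟶-csuc (vtx n) , ⟶-csuc (vtx (1 + n)) , even-gap n h>0)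
                                (step₁ n , step₁ (1 + n) , p))

    -- The vertices at offsets 0, 2j + 1, 2j + 2 form a `⟶`-cyclic triple. Consequently the first
    -- vertex after `vtx n` that dominates it has odd offset.
    extend : ∀ n {j} → j < h → vtx n ⇒ vtx (suc (j * 2) + n) → vtx n ⇒ vtx (suc j * 2 + n)
    extend n {j} j<h p with order-even n j<h
    ... | inj₁ q = q
    ... | inj₂ q = ⊥-elim (disj (odd-gap n j<h , ⟶-csuc (vtx (suc (j * 2) + n)) , even-gap n j<h)
                                (p , step₁ (suc (j * 2) + n) , q))

    -- Let `z`, `x`, `x₁`, `x₂`, `x₃` be the vertices at offsets 0, 2j + 1, ..., 2j + 4, and suppose
    -- `x ⇒ x₃`. If `z ⇒ x₃`, then `x₃` is a sink of the cyclic triple `z`, `x₁`, `x₂`; if `x₃ ⇒ z`,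
    -- then `z`, `x`, `x₃` is cyclic in both tournaments.
    turn : ∀ n {j} → suc j < h → vtx n ⇒ vtx (1 + j * 2 + n) → vtx n ⇒ vtx (2 + j * 2 + n) →
           vtx (3 + j * 2 + n) ⇒ vtx n → vtx (4 + j * 2 + n) ⇒ vtx (1 + j * 2 + n)
    turn n {j} j+1<h z⇒x z⇒x₁ x₂⇒z with order-odd (1 + j * 2 + n) 1<h | order-even n j+1<h
      where
      1<h : 1 < h
      1<h = ℕ.≤-trans (s≤s (s≤s z≤n)) j+1<h
    ... | inj₂ x₃⇒x | _         = x₃⇒x
    ... | inj₁ x⇒x₃ | inj₁ z⇒x₃ = ⊥-elim (noSink B (z⇒x₁ , step₁ (2 + j * 2 + n) , x₂⇒z)
                                                    z⇒x₃ (step₂ (2 + j * 2 + n)) (step₁ (3 + j * 2 + n)))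
    ... | inj₁ x⇒x₃ | inj₂ x₃⇒z = ⊥-elim (disj (odd-gap n (ℕ.<⇒≤ j+1<h)
                                                , odd-gap (1 + j * 2 + n) (ℕ.≤-trans (s≤s (s≤s z≤n)) j+1<h)
                                                , even-gap n j+1<h)
                                               (z⇒x , x⇒x₃ , x₃⇒z))

    turn-suc : 1 < h → ∀ n → vtx (3 + n) ⇒ vtx n → vtx (4 + n) ⇒ vtx (1 + n)
    turn-suc 1<h n = turn n 1<h (step₁ n) (step₂ n)

    -- Otherwise `vtx n` would dominate the vertices at offsets 1, 2, 4, which form a cyclic triple
    -- by `turn-suc`.
    turn₄ : 1 < h → ∀ n → vtx (3 + n) ⇒ vtx n → vtx (4 + n) ⇒ vtx n
    turn₄ 1<h n t with order-even n 1<h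
    ... | inj₁ p = ⊥-elim (noSource B (step₁ (1 + n) , step₂ (2 + n) , turn-suc 1<h n t) (step₁ n) (step₂ n) p)
    ... | inj₂ p = p

    -- Offset 6 is less than `k`. If 0 dominates 6, the offsets 0, 3, 6 are cyclic for `⟶` and for
    -- `flip _⇒_`; if 6 dominates 0, it dominates the whole cyclic triple 0, 2, 3.
    no-turn : 3 ≤ h → ∀ n → ¬ vtx (3 + n) ⇒ vtx n
    no-turn 3≤h n t₀ = [ below , above ]′ (order-even n 3≤h)
      where
      1<h : 1 < h
      1<h = ℕ.<⇒≤ 3≤h
      t₂ : vtx (5 + n) ⇒ vtx (2 + n)
      t₂ = turn-suc 1<h (1 + n) (turn-suc 1<h n t₀)
      t₃ : vtx (6 + n) ⇒ vtx (3 + n)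
      t₃ = turn-suc 1<h (2 + n) t₂
      below : ¬ vtx n ⇒ vtx (6 + n)
      below p = disjᵒ (odd-gap n 1<h , odd-gap (3 + n) 1<h , even-gap n 3≤h) (t₀ , t₃ , p)
      above : ¬ vtx (6 + n) ⇒ vtx n
      above p = noSource B (step₂ n , step₁ (2 + n) , t₀) p (turn₄ 1<h (2 + n) t₂) t₃

    -- Searches the odd offsets for the first vertex that dominates `vtx 0`, with `d` of them left
    -- to test. At such a vertex `turn` yields a reversed arc of length three, against `no-turn`. If
    -- none occurs, `vtx 0` dominates the last vertex, against the closing arc of the cycle.
    sweep : 3 ≤ h → ∀ d j → suc d + j ≡ h → ¬ vtx 0 ⇒ vtx (1 + j * 2 + 0)
    sweep 3≤h zero    j refl p =
      asym B (extend 0 ℕ.≤-refl p) (subst (vtx (suc j * 2 + 0) ⇒_) (vtx-period 0) (step₁ (suc j * 2 + 0)))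
    sweep 3≤h (suc d) j e    p = [ sweep 3≤h d (suc j) (trans (cong suc (ℕ.+-suc d j)) e) , turned ]′ (order-odd 0 j+1<h)
      where
      j+1<h : suc j < h
      j+1<h = subst (suc j <_) e (s≤s (s≤s (ℕ.m≤n+m j d)))
      turned : ¬ vtx (suc (suc j * 2) + 0) ⇒ vtx 0
      turned q = no-turn 3≤h (1 + j * 2 + 0) (turn 0 j+1<h p (extend 0 (ℕ.<⇒≤ j+1<h) p) q)

    h<3 : ¬ 3 ≤ h
    h<3 3≤h@(s≤s {n = d} _) = sweep 3≤h d 0 (ℕ.+-comm (suc d) 0) start

    h≢1 : h ≢ 1
    h≢1 refl = asym B (step₁ 0) (subst (vtx 1 ⇒_) (vtx-period 0) (step₂ 1))

-- Neighbours in a cubic graph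

third-index : (a b : Fin 3) → a ≢ b → ∃ λ c → c ≢ a × c ≢ b × (∀ d → d ≡ a ⊎ d ≡ b ⊎ d ≡ c)
third-index = from-yes (all? λ (a : Fin 3) → all? λ (b : Fin 3) → ¬? (a ≟ᶠ b) →-dec any? λ c →
  ¬? (c ≟ᶠ a) ×-dec ¬? (c ≟ᶠ b) ×-dec all? λ d → d ≟ᶠ a ⊎-dec d ≟ᶠ b ⊎-dec d ≟ᶠ c)

lookup-injective : {A : Set} {xs : List A} → Unique xs → Injective _≡_ _≡_ (lookup xs)
lookup-injective (_ ∷ _)    {zero}  {zero}  _ = refl
lookup-injective (x∉xs ∷ _) {zero}  {suc j} e = ⊥-elim (All.lookup x∉xs (∈-lookup j) e)
lookup-injective (x∉xs ∷ _) {suc i} {zero}  e = ⊥-elim (All.lookup x∉xs (∈-lookup i) (sym e))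
lookup-injective (_ ∷ u)    {suc i} {suc j} e = cong suc (lookup-injective u e)

third-element : {A : Set} {xs : List A} → Unique xs → length xs ≡ 3 →
                ∀ {s p} → s ∈ xs → p ∈ xs → s ≢ p →
                ∃ λ t → t ∈ xs × t ≢ s × t ≢ p × (∀ {w} → w ∈ xs → w ≡ s ⊎ w ≡ p ⊎ w ≡ t)
third-element {xs = xs@(_ ∷ _ ∷ _ ∷ [])} u _ s∈ p∈ s≢p
  with third-index (index s∈) (index p∈)
         (λ e → s≢p (trans (lookup-index s∈) (trans (cong (lookup xs) e) (sym (lookup-index p∈)))))
... | c , c≢s , c≢p , only =
  lookup xs c , ∈-lookup c
  , (λ e → c≢s (lookup-injective u (trans e (lookup-index s∈))))
  , (λ e → c≢p (lookup-injective u (trans e (lookup-index p∈))))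
  , λ w∈ → Sum.map (same w∈ s∈) (Sum.map (same w∈ p∈) (λ e → trans (lookup-index w∈) (cong (lookup xs) e)))
                        (only (index w∈))
  where
  same : ∀ {v w} (v∈ : v ∈ xs) (w∈ : w ∈ xs) → index v∈ ≡ index w∈ → v ≡ w
  same v∈ w∈ e = trans (lookup-index v∈) (trans (cong (lookup xs) e) (sym (lookup-index w∈)))

third-neighbour : ∀ G v → degree G v ≡ 3 → ∀ {s p} → adj G v s ≡ true → adj G v p ≡ true → s ≢ p →
                  ∃ λ t → adj G v t ≡ true × t ≢ s × t ≢ p ×
                          (∀ {w} → adj G v w ≡ true → w ≡ s ⊎ w ≡ p ⊎ w ≡ t)
third-neighbour G v deg s~ p~ s≢p =
  let (t , t∈ , t≢s , t≢p , only) = third-element (filter⁺ (T? ∘ adj G v) (allFin⁺ _)) deg (enter s~) (enter p~) s≢p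
  in t , leave t∈ , t≢s , t≢p , λ w~ → only (enter w~)
  where
  neighbours : List (Fin (n G))
  neighbours = filter (T? ∘ adj G v) (allFin (n G))
  enter : ∀ {w} → adj G v w ≡ true → w ∈ neighbours
  enter w~ = ∈-filter⁺ (T? ∘ adj G v) (∈-allFin _) (Equivalence.from T-≡ w~)
  leave : ∀ {w} → w ∈ neighbours → adj G v w ≡ true
  leave w∈ = Equivalence.to T-≡ (proj₂ (∈-filter⁻ (T? ∘ adj G v) {xs = allFin (n G)} w∈))

-- Chordless cycles and the crossing permutation

cpred : ∀ {k} → Fin k → Fin k
cpred {suc m} zero    = fromℕ m
cpred {suc m} (suc i) = inject₁ i

csuc-cpred : ∀ {k} (i : Fin k) → csuc (cpred i) ≡ i
csuc-cpred {suc m} zero with csuc-cases (fromℕ m)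
... | inj₁ (_ , p) = ⊥-elim (ℕ.<⇒≢ p (toℕ-fromℕ m))
... | inj₂ (e , _) = e
csuc-cpred {suc m} (suc i) with csuc-cases (inject₁ i)
... | inj₁ (e , _) = toℕ-injective (trans e (cong suc (toℕ-inject₁ i)))
... | inj₂ (_ , e) = ⊥-elim (ℕ.<⇒≢ (toℕ<n i) (trans (sym (toℕ-inject₁ i)) e))

cpred-csuc : ∀ {k} (i : Fin k) → cpred (csuc i) ≡ i
cpred-csuc i = csuc-injective (csuc-cpred (csuc i))

csuc²≢ : ∀ {k} → 3 ≤ k → (i : Fin k) → csuc (csuc i) ≢ i
csuc²≢ {suc m} 3≤k i e with csuc-cases i
... | inj₂ (p , i≡m) with csuc-cases (csuc i)
...   | inj₁ (q , _) = ℕ.<⇒≢ (ℕ.≤-pred 3≤k) (trans (sym (trans q (cong (suc ∘ toℕ) p))) (trans (cong toℕ e) i≡m))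
...   | inj₂ (q , r) with refl ← trans (cong toℕ (sym p)) r with s≤s () ← 3≤k
csuc²≢ {suc m} 3≤k i e | inj₁ (p , i<m) with csuc-cases (csuc i)
...   | inj₁ (q , _) = ℕ.<⇒≢ (ℕ.m<n⇒m<1+n ℕ.≤-refl) (sym (trans (sym (trans q (cong suc p))) (cong toℕ e)))
...   | inj₂ (q , r) = ℕ.<⇒≢ (ℕ.≤-pred 3≤k) (trans (cong suc (cong toℕ (trans (sym q) e))) (trans (sym p) r))

-- The length is a parameter, unlike in `Cycle`, so that two cycles can share a type once their
-- lengths are known to agree.
record ChordlessCycle (G : Graph) (k : ℕ) : Set where
  field
    3≤k       : 3 ≤ k
    at        : Fin k → Fin (n G)
    at-inj    : Injective _≡_ _≡_ at
    at-csuc   : ∀ i → adj G (at i) (at (csuc i)) ≡ true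
    chordless : ∀ i j → adj G (at i) (at j) ≡ true → j ≡ csuc i ⊎ i ≡ csuc j

open ChordlessCycle

chordlessCycle : ∀ {G} (C : Cycle G) → Chordless C → ChordlessCycle G (len C)
chordlessCycle C ch = record
  { 3≤k = len≥3 C ; at = vert C ; at-inj = inj C ; at-csuc = edges C ; chordless = ch }

record TwoFactor {G : Graph} {k l : ℕ} (X : ChordlessCycle G k) (Y : ChordlessCycle G l) : Set where
  field
    cover    : ∀ v → (∃ λ i → at X i ≡ v) ⊎ (∃ λ j → at Y j ≡ v)
    disjoint : ∀ i j → at X i ≢ at Y j

open TwoFactor

-- The third neighbour of `at X i`, besides its two neighbours along `X`, cannot lie on `X`, where
-- it would give a chord. So it lies on `Y`, and it is the only neighbour there.
partner : ∀ {G k l} {X : ChordlessCycle G k} {Y : ChordlessCycle G l} → Cubic G → TwoFactor X Y →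
          ∀ i → ∃ λ j → adj G (at X i) (at Y j) ≡ true × (∀ {j′} → adj G (at X i) (at Y j′) ≡ true → j′ ≡ j)
partner {G} {X = X} {Y} cubic F i
  with third-neighbour G (at X i) (cubic (at X i)) (at-csuc X i) prev~
         (λ e → csuc²≢ (3≤k X) i (trans (cong csuc (at-inj X e)) (csuc-cpred i)))
  where
  prev~ : adj G (at X i) (at X (cpred i)) ≡ true
  prev~ = trans (adj-sym G _ _) (subst (λ j → adj G (at X (cpred i)) (at X j) ≡ true) (csuc-cpred i) (at-csuc X (cpred i)))
... | t , t~ , t≢s , t≢p , only with cover F t
...   | inj₁ (i′ , refl) = ⊥-elim ([ (λ e → t≢s (cong (at X) e))
                                   , (λ e → t≢p (cong (at X) (sym (trans (cong cpred e) (cpred-csuc i′)))))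
                                   ]′ (chordless X i i′ t~))
...   | inj₂ (j , refl)  = j , t~ , λ w~ → [ (λ e → ⊥-elim (disjoint F (csuc i) _ (sym e)))
                                           , [ (λ e → ⊥-elim (disjoint F (cpred i) _ (sym e))) , at-inj Y ]′
                                           ]′ (only w~)

-- Each edge is listed in one direction; adjacency is therefore `Link q x y ⊎ Link q y x`.
data Link {k : ℕ} (q : Fin k → Fin k) : Fin k ⊎ Fin k → Fin k ⊎ Fin k → Set where
  outer : ∀ i → Link q (inj₁ i) (inj₁ (csuc i))
  inner : ∀ j → Link q (inj₂ j) (inj₂ (csuc j))
  spoke : ∀ i → Link q (inj₁ i) (inj₂ (q i))

left-inverse⇒injective : {A B : Set} {f : A → B} (g : B → A) → (∀ x → g (f x) ≡ x) → Injective _≡_ _≡_ f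
left-inverse⇒injective g gf {x} {y} e = trans (sym (gf x)) (trans (cong g e) (gf y))

-- A normal form for permutation graphs: two copies of the `k`-cycle joined by the permutation `q`,
-- with `ψ` as the isomorphism.
record Permuted (G : Graph) (k : ℕ) : Set where
  field
    q q⁻   : Fin k → Fin k
    q⁻∘q   : ∀ i → q⁻ (q i) ≡ i
    q∘q⁻   : ∀ j → q (q⁻ j) ≡ j
    ψ      : Fin k ⊎ Fin k → Fin (n G)
    ψ⁻     : Fin (n G) → Fin k ⊎ Fin k
    ψ∘ψ⁻   : ∀ v → ψ (ψ⁻ v) ≡ v
    ψ⁻∘ψ   : ∀ x → ψ⁻ (ψ x) ≡ x
    adj⇒   : ∀ x y → adj G (ψ x) (ψ y) ≡ true → Link q x y ⊎ Link q y x
    adj⇐   : ∀ {x y} → Link q x y → adj G (ψ x) (ψ y) ≡ true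

  q-injective : Injective _≡_ _≡_ q
  q-injective = left-inverse⇒injective q⁻ q⁻∘q

swapped : ∀ {G k l} {X : ChordlessCycle G k} {Y : ChordlessCycle G l} → TwoFactor X Y → TwoFactor Y X
swapped F = record { cover = swap ∘ cover F ; disjoint = λ j i e → disjoint F i j (sym e) }

crossing : ∀ {G k l} {X : ChordlessCycle G k} {Y : ChordlessCycle G l} → Cubic G → TwoFactor X Y → Fin k → Fin l
crossing cubic F i = proj₁ (partner cubic F i)

crossing-inverse : ∀ {G k l} {X : ChordlessCycle G k} {Y : ChordlessCycle G l} (cubic : Cubic G)
                 (F : TwoFactor X Y) (F′ : TwoFactor Y X) → ∀ i → crossing cubic F′ (crossing cubic F i) ≡ i
crossing-inverse {G} cubic F F′ i =
  sym (proj₂ (proj₂ (partner cubic F′ _)) (trans (adj-sym G _ _) (proj₁ (proj₂ (partner cubic F i)))))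

lengths-agree : ∀ {G k l} {X : ChordlessCycle G k} {Y : ChordlessCycle G l} → Cubic G → TwoFactor X Y → k ≡ l
lengths-agree cubic F = cantor-schröder-bernstein
  (left-inverse⇒injective (crossing cubic (swapped F)) (crossing-inverse cubic F (swapped F)))
  (left-inverse⇒injective (crossing cubic F) (crossing-inverse cubic (swapped F) F))

permuted : ∀ {G k} {X Y : ChordlessCycle G k} → Cubic G → TwoFactor X Y → Permuted G k
permuted {G} {k} {X} {Y} cubic F = record
  { q = σ ; q⁻ = crossing cubic (swapped F)
  ; q⁻∘q = crossing-inverse cubic F (swapped F) ; q∘q⁻ = crossing-inverse cubic (swapped F) F
  ; ψ = ψ ; ψ⁻ = λ v → locate (cover F v) ; ψ∘ψ⁻ = λ v → at-locate (cover F v)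
  -- `cover` only promises some preimage of the vertex; injectivity of `ψ` identifies it with `x`.
  ; ψ⁻∘ψ = λ x → ψ-injective _ x (at-locate (cover F (ψ x)))
  ; adj⇒ = adj⇒ ; adj⇐ = adj⇐
  }
  where
  σ : Fin k → Fin k
  σ = crossing cubic F
  ψ : Fin k ⊎ Fin k → Fin (n G)
  ψ = [ at X , at Y ]′
  locate : ∀ {v} → (∃ λ i → at X i ≡ v) ⊎ (∃ λ j → at Y j ≡ v) → Fin k ⊎ Fin k
  locate = Sum.map proj₁ proj₁
  at-locate : ∀ {v} (c : (∃ λ i → at X i ≡ v) ⊎ (∃ λ j → at Y j ≡ v)) → ψ (locate c) ≡ v
  at-locate (inj₁ (_ , e)) = e
  at-locate (inj₂ (_ , e)) = e
  ψ-injective : ∀ x y → ψ x ≡ ψ y → x ≡ y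
  ψ-injective (inj₁ i) (inj₁ j) e = cong inj₁ (at-inj X e)
  ψ-injective (inj₁ i) (inj₂ j) e = ⊥-elim (disjoint F i j e)
  ψ-injective (inj₂ i) (inj₁ j) e = ⊥-elim (disjoint F j i (sym e))
  ψ-injective (inj₂ i) (inj₂ j) e = cong inj₂ (at-inj Y e)
  crossing-unique : ∀ i j → adj G (at X i) (at Y j) ≡ true → Link σ (inj₁ i) (inj₂ j)
  crossing-unique i j e with refl ← proj₂ (proj₂ (partner cubic F i)) e = spoke i
  adj⇒ : ∀ x y → adj G (ψ x) (ψ y) ≡ true → Link σ x y ⊎ Link σ y x
  adj⇒ (inj₁ i) (inj₁ j) e = Sum.map (λ { refl → outer i }) (λ { refl → outer j }) (chordless X i j e)
  adj⇒ (inj₁ i) (inj₂ j) e = inj₁ (crossing-unique i j e)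
  adj⇒ (inj₂ i) (inj₁ j) e = inj₂ (crossing-unique j i (trans (adj-sym G _ _) e))
  adj⇒ (inj₂ i) (inj₂ j) e = Sum.map (λ { refl → inner i }) (λ { refl → inner j }) (chordless Y i j e)
  adj⇐ : ∀ {x y} → Link σ x y → adj G (ψ x) (ψ y) ≡ true
  adj⇐ (outer i) = at-csuc X i
  adj⇐ (inner j) = at-csuc Y j
  adj⇐ (spoke i) = proj₁ (proj₂ (partner cubic F i))

permutationGraph⇒permuted : ∀ {G} → PermutationGraph G → ∃ λ k → 3 ≤ k × Permuted G k
permutationGraph⇒permuted {G} (cubic , C , C′ , ch , ch′ , cov , disj) =
  len C , len≥3 C , unify (lengths-agree cubic F) (chordlessCycle C′ ch′) F
  where
  F : TwoFactor (chordlessCycle C ch) (chordlessCycle C′ ch′)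
  F = record { cover = cov ; disjoint = disj }
  unify : ∀ {k l} {X : ChordlessCycle G k} → k ≡ l → (Y : ChordlessCycle G l) → TwoFactor X Y → Permuted G k
  unify refl Y F = permuted cubic F

-- Perfect matchings described by moves

data Move : Set where
  forth back across : Move

alternate : Bool → Move
alternate true  = forth
alternate false = back

module _ {G : Graph} {k : ℕ} (P : Permuted G k) where
  open Permuted P

  follow₁ follow₂ : Fin k → Move → Fin k ⊎ Fin k
  follow₁ i forth  = inj₁ (csuc i)
  follow₁ i back   = inj₁ (cpred i)
  follow₁ i across = inj₂ (q i)
  follow₂ j forth  = inj₂ (csuc j)
  follow₂ j back   = inj₂ (cpred j)
  follow₂ j across = inj₁ (q⁻ j)

  -- A perfect matching, given by the direction in which each vertex of the two cycles is matched.
  record Plan : Set where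
    field
      move₁ move₂ : Fin k → Move
      forth₁  : ∀ {i} → move₁ i ≡ forth → move₁ (csuc i) ≡ back
      back₁   : ∀ {i} → move₁ (csuc i) ≡ back → move₁ i ≡ forth
      forth₂  : ∀ {j} → move₂ j ≡ forth → move₂ (csuc j) ≡ back
      back₂   : ∀ {j} → move₂ (csuc j) ≡ back → move₂ j ≡ forth
      across₁ : ∀ {i} → move₁ i ≡ across → move₂ (q i) ≡ across
      across₂ : ∀ {i} → move₂ (q i) ≡ across → move₁ i ≡ across

    mate : Fin k ⊎ Fin k → Fin k ⊎ Fin k
    mate (inj₁ i) = follow₁ i (move₁ i)
    mate (inj₂ j) = follow₂ j (move₂ j)

    mate-involutive : ∀ x → mate (mate x) ≡ x
    mate-involutive (inj₁ i) with move₁ i in e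
    ... | forth  rewrite forth₁ e = cong inj₁ (cpred-csuc i)
    ... | back   rewrite back₁ (trans (cong move₁ (csuc-cpred i)) e) = cong inj₁ (csuc-cpred i)
    ... | across rewrite across₁ e = cong inj₁ (q⁻∘q i)
    mate-involutive (inj₂ j) with move₂ j in e
    ... | forth  rewrite forth₂ e = cong inj₂ (cpred-csuc j)
    ... | back   rewrite back₂ (trans (cong move₂ (csuc-cpred j)) e) = cong inj₂ (csuc-cpred j)
    ... | across rewrite across₂ (trans (cong move₂ (q∘q⁻ j)) e) = cong inj₂ (q∘q⁻ j)

    mate-link : ∀ x → Link q x (mate x) ⊎ Link q (mate x) x
    mate-link (inj₁ i) with move₁ i
    ... | forth  = inj₁ (outer i)
    ... | back   = inj₂ (subst (λ j → Link q (inj₁ (cpred i)) (inj₁ j)) (csuc-cpred i) (outer (cpred i)))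
    ... | across = inj₁ (spoke i)
    mate-link (inj₂ j) with move₂ j
    ... | forth  = inj₁ (inner j)
    ... | back   = inj₂ (subst (λ i → Link q (inj₂ (cpred j)) (inj₂ i)) (csuc-cpred j) (inner (cpred j)))
    ... | across = inj₂ (subst (λ i → Link q (inj₁ (q⁻ j)) (inj₂ i)) (q∘q⁻ j) (spoke (q⁻ j)))

    mateᴳ : Fin (n G) → Fin (n G)
    mateᴳ v = ψ (mate (ψ⁻ v))

    mateᴳ-involutive : ∀ v → mateᴳ (mateᴳ v) ≡ v
    mateᴳ-involutive v =
      trans (cong (ψ ∘ mate) (ψ⁻∘ψ _)) (trans (cong ψ (mate-involutive (ψ⁻ v))) (ψ∘ψ⁻ v))

    mateᴳ-adj : ∀ v → adj G v (mateᴳ v) ≡ true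
    mateᴳ-adj v = subst (λ u → adj G u (mateᴳ v) ≡ true) (ψ∘ψ⁻ v)
      ([ adj⇐ , (λ l → trans (adj-sym G _ _) (adj⇐ l)) ]′ (mate-link (ψ⁻ v)))

    mateᴳ-flip : ∀ {u v} → mateᴳ u ≡ v → mateᴳ v ≡ u
    mateᴳ-flip {u} refl = mateᴳ-involutive u

    matching : PerfectMatching G
    matching = record
      { inM     = λ u v → does (mateᴳ u ≟ᶠ v)
      ; inM-sym = λ u v → does-⇔ (mk⇔ mateᴳ-flip mateᴳ-flip) (mateᴳ u ≟ᶠ v) (mateᴳ v ≟ᶠ u)
      ; inM⊆E   = λ u v e → subst (λ w → adj G u w ≡ true) (does-true e) (mateᴳ-adj u)
      ; unique  = λ v → mateᴳ v , dec-true (mateᴳ v ≟ᶠ mateᴳ v) refl , λ w e → sym (does-true e)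
      }
      where
      does-true : ∀ {u v : Fin (n G)} → does (u ≟ᶠ v) ≡ true → u ≡ v
      does-true {u} {v} e with u ≟ᶠ v
      ... | yes p = p

    covers : ∀ {x y} → mate x ≡ y → inM matching (ψ x) (ψ y) ≡ true
    covers {x} refl = dec-true (_ ≟ᶠ _) (cong (ψ ∘ mate) (ψ⁻∘ψ x))

  open Plan

  -- One direction of each edge is enough, because `mate` is an involution.
  cover⇒τ≤ : ∀ {b} (Ms : List Plan) → length Ms ≤ b → (∀ {x y} → Link q x y → Any (λ M → mate M x ≡ y) Ms) → τ≤ G b
  cover⇒τ≤ Ms short cov = map matching Ms , subst (_≤ _) (sym (length-map matching Ms)) short , λ u v u~v →
    map⁺ (Any.map (λ {M} e → subst₂ (λ u v → inM (matching M) u v ≡ true) (ψ∘ψ⁻ u) (ψ∘ψ⁻ v) (covers M e))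
                  (pick (adj⇒ (ψ⁻ u) (ψ⁻ v) (subst₂ (λ u v → adj G u v ≡ true) (sym (ψ∘ψ⁻ u)) (sym (ψ∘ψ⁻ v)) u~v))))
    where
    pick : ∀ {x y} → Link q x y ⊎ Link q y x → Any (λ M → mate M x ≡ y) Ms
    pick (inj₁ l) = cov l
    pick (inj₂ l) = Any.map (λ {M} e → trans (cong (mate M) (sym e)) (mate-involutive M _)) (cov l)

  acrossPlan : Plan
  acrossPlan = record
    { move₁ = λ _ → across ; move₂ = λ _ → across
    ; forth₁ = λ () ; back₁ = λ () ; forth₂ = λ () ; back₂ = λ ()
    ; across₁ = λ _ → refl ; across₂ = λ _ → refl
    }

  module _ (colour : Fin k → Bool) (colour-csuc : ∀ i → colour (csuc i) ≡ not (colour i)) where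

    alternate-forth : ∀ {i} → alternate (colour i) ≡ forth → alternate (colour (csuc i)) ≡ back
    alternate-forth {i} e rewrite colour-csuc i with colour i
    ... | true = refl

    alternate-back : ∀ {i} → alternate (colour (csuc i)) ≡ back → alternate (colour i) ≡ forth
    alternate-back {i} e rewrite colour-csuc i with colour i
    ... | true = refl

    alternate≢across : ∀ {i} → alternate (colour i) ≢ across
    alternate≢across {i} e with colour i
    alternate≢across {i} () | true
    alternate≢across {i} () | false

    alternatingPlan : Plan
    alternatingPlan = record
      { move₁ = alternate ∘ colour ; move₂ = alternate ∘ colour
      ; forth₁ = alternate-forth ; back₁ = alternate-back ; forth₂ = alternate-forth ; back₂ = alternate-back
      ; across₁ = ⊥-elim ∘ alternate≢across ; across₂ = ⊥-elim ∘ alternate≢across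
      }

  -- The colouring splits each cycle into two alternating matchings, so that three perfect
  -- matchings, one of them the set of spokes, cover all edges.
  bipartite⇒τ≤4 : (colour : Fin k → Bool) → (∀ i → colour (csuc i) ≡ not (colour i)) → τ≤ G 4
  bipartite⇒τ≤4 colour colour-csuc =
    cover⇒τ≤ (acrossPlan ∷ alternatingPlan colour colour-csuc
                         ∷ alternatingPlan (not ∘ colour) (cong not ∘ colour-csuc) ∷ [])
             (s≤s (s≤s (s≤s z≤n))) cov
    where
    cov : ∀ {x y} → Link q x y → Any (λ M → mate M x ≡ y) _
    cov (spoke i) = here refl
    cov (outer i) with colour i in e
    ... | true  = there (here (cong (follow₁ i ∘ alternate) e))
    ... | false = there (there (here (cong (follow₁ i ∘ alternate ∘ not) e)))
    cov (inner j) with colour j in e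
    ... | true  = there (here (cong (follow₂ j ∘ alternate) e))
    ... | false = there (there (here (cong (follow₂ j ∘ alternate ∘ not) e)))

-- Matchings with a single spoke

data Side {k : ℕ} (x i : Fin k) : Move → Set where
  coincide : x ≡ i → Side x i across
  ahead    : x ⟶ i → Side x i forth
  behind   : i ⟶ x → Side x i back

side : ∀ {k} (x i : Fin k) → ∃ (Side x i)
side x i with x ≟ᶠ i
... | yes e = across , coincide e
... | no ne = [ (λ p → forth , ahead p) , (λ p → back , behind p) ]′ (⟶-total ne)

-- On an odd cycle without `x`, the vertices at odd distance from `x` are matched with their
-- successors and the others with their predecessors; `x` itself takes its spoke.
move : ∀ {k} → Fin k → Fin k → Move
move x i = proj₁ (side x i)

side-unique : ∀ {k} {x i : Fin k} {m m′} → Side x i m → Side x i m′ → m ≡ m′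
side-unique (coincide _)    (coincide _)    = refl
side-unique (coincide refl) (ahead p)   = ⊥-elim (⟶-asym p p)
side-unique (coincide refl) (behind p)  = ⊥-elim (⟶-asym p p)
side-unique (ahead p)   (coincide refl) = ⊥-elim (⟶-asym p p)
side-unique (ahead p)   (ahead _)   = refl
side-unique (ahead p)   (behind q)  = ⊥-elim (⟶-asym p q)
side-unique (behind p)  (coincide refl) = ⊥-elim (⟶-asym p p)
side-unique (behind p)  (ahead q)   = ⊥-elim (⟶-asym p q)
side-unique (behind p)  (behind _)  = refl

move-≡ : ∀ {k} {x i : Fin k} {m} → Side x i m → move x i ≡ m
move-≡ s = side-unique (proj₂ (side _ _)) s

across-≡ : ∀ {k} {x i : Fin k} → move x i ≡ across → x ≡ i
across-≡ {x = x} {i} e with side x i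
... | _ , coincide x≡i = x≡i

⟶? : ∀ {k} → Decidable (_⟶_ {k})
⟶? i j with side i j
... | _ , ahead p    = yes p
... | _ , coincide refl  = no (λ p → ⟶-asym p p)
... | _ , behind p   = no (⟶-asym p)

module OddMoves (h : ℕ) (h>0 : 0 < h) where
  open OddCycle h h>0

  move-forth : ∀ x {i} → move x i ≡ forth → move x (csuc i) ≡ back
  move-forth x {i} e with side x i
  ... | _ , ahead x⟶i = move-≡ (behind (⟶-flip x⟶i))

  move-back : ∀ x {i} → move x (csuc i) ≡ back → move x i ≡ forth
  move-back x {i} e with side x (csuc i)
  ... | _ , behind c⟶x with side x i
  ...   | _ , coincide refl  = ⊥-elim (⟶-asym c⟶x (⟶-csuc i))
  ...   | _ , ahead _    = refl
  ...   | _ , behind i⟶x = ⊥-elim (⟶-asym c⟶x (⟶-flip⁻ i⟶x (⇒-≢ ⟶-locallyTransitive c⟶x)))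

  -- A vertex of the triple is dominated by the one before it; any other vertex would be a source of
  -- the triple if none of the three dominated it.
  dominator : ∀ {x y z : Fin k} → Cyclic _⟶_ x y z → ∀ i → x ⟶ i ⊎ y ⟶ i ⊎ z ⟶ i
  dominator {x} {y} {z} cyc@(x⟶y , y⟶z , z⟶x) i with side x i | side y i | side z i
  ... | _ , ahead p    | _              | _              = inj₁ p
  ... | _              | _ , ahead p    | _              = inj₂ (inj₁ p)
  ... | _              | _              | _ , ahead p    = inj₂ (inj₂ p)
  ... | _ , coincide refl  | _              | _              = inj₂ (inj₂ z⟶x)
  ... | _              | _ , coincide refl  | _              = inj₁ x⟶y
  ... | _              | _              | _ , coincide refl  = inj₂ (inj₁ y⟶z)
  ... | _ , behind p   | _ , behind p′  | _ , behind p″  = ⊥-elim (⟶-noSource cyc p p′ p″)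

-- Covering by a common cyclic triple

module OddPermutation {G : Graph} (h : ℕ) (h>0 : 0 < h) (P : Permuted G (suc (h * 2))) where
  open OddCycle h h>0
  open OddMoves h h>0
  open Permuted P

  _⇒_ : Rel (Fin k) _
  _⇒_ = _⟶_ on q

  ⇒-locallyTransitive : LocallyTransitive _⇒_
  ⇒-locallyTransitive = pullback q q-injective (λ j → q⁻ j , q∘q⁻ j) ⟶-locallyTransitive

  -- The two cycles omit the two ends of one spoke, so this spoke completes the two near-perfect
  -- matchings.
  spokePlan : Fin k → Plan P
  spokePlan x = record
    { move₁ = move x ; move₂ = move (q x)
    ; forth₁ = move-forth x ; back₁ = move-back x ; forth₂ = move-forth (q x) ; back₂ = move-back (q x)
    ; across₁ = λ e → move-≡ (coincide (cong q (across-≡ e)))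
    ; across₂ = λ e → move-≡ (coincide (q-injective (across-≡ e)))
    }

  Cyclicᵒ : Rel (Fin k) _ → Fin k → Fin k → Fin k → Set
  Cyclicᵒ _R_ x y z = Cyclic _R_ x y z ⊎ Cyclic (flip _R_) x y z

  dominatorᵒ : ∀ {x y z : Fin k} → Cyclicᵒ _⇒_ x y z → ∀ j → q x ⟶ j ⊎ q y ⟶ j ⊎ q z ⟶ j
  dominatorᵒ (inj₁ cyc)         j = dominator cyc j
  -- In this case `x`, `z`, `y` is the cyclic order, hence the exchange of the last two
  -- alternatives.
  dominatorᵒ (inj₂ (p , r , s)) j = [ inj₁ , [ inj₂ ∘ inj₂ , inj₂ ∘ inj₁ ]′ ]′ (dominator (s , r , p) j)

  commonTriangle⇒τ≤4 : ∀ {x y z : Fin k} → Cyclic _⟶_ x y z → Cyclicᵒ _⇒_ x y z → τ≤ G 4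
  commonTriangle⇒τ≤4 {x} {y} {z} cyc cycᵒ = cover⇒τ≤ P plans ℕ.≤-refl cov
    where
    plans : List (Plan P)
    plans = acrossPlan P ∷ spokePlan x ∷ spokePlan y ∷ spokePlan z ∷ []
    cov : ∀ {u v} → Link q u v → Any (λ M → Plan.mate M u ≡ v) plans
    cov (spoke i) = here refl
    cov (outer i) =
      [ there ∘ here ∘ f , [ there ∘ there ∘ here ∘ f , there ∘ there ∘ there ∘ here ∘ f ]′ ]′ (dominator cyc i)
      where
      f : ∀ {x} → x ⟶ i → follow₁ P i (move x i) ≡ inj₁ (csuc i)
      f p = cong (follow₁ P i) (move-≡ (ahead p))
    cov (inner j) =
      [ there ∘ here ∘ f , [ there ∘ there ∘ here ∘ f , there ∘ there ∘ there ∘ here ∘ f ]′ ]′ (dominatorᵒ cycᵒ j)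
      where
      f : ∀ {x} → x ⟶ j → follow₂ P j (move x j) ≡ inj₂ (csuc j)
      f p = cong (follow₂ P j) (move-≡ (ahead p))

  cyclic? : ∀ (x y z : Fin k) → Dec (Cyclic _⟶_ x y z)
  cyclic? x y z = ⟶? x y ×-dec ⟶? y z ×-dec ⟶? z x

  CommonTriangle : Set
  CommonTriangle = ∃ λ x → ∃ λ y → ∃ λ z → Cyclic (_⟶_ {k}) x y z × Cyclicᵒ _⇒_ x y z

  commonTriangle? : Dec CommonTriangle
  commonTriangle? = any? λ x → any? λ y → any? λ z →
    cyclic? x y z ×-dec (cyclic? (q x) (q y) (q z) ⊎-dec (⟶? (q y) (q x) ×-dec ⟶? (q z) (q y) ×-dec ⟶? (q x) (q z)))

-- The Petersen graph as rim, pentagram and spokes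

data PetersenLink : Fin 5 ⊎ Fin 5 → Fin 5 ⊎ Fin 5 → Set where
  rim   : ∀ i → PetersenLink (inj₁ i) (inj₁ (csuc i))
  star  : ∀ i → PetersenLink (inj₂ i) (inj₂ (csuc (csuc i)))
  spoke : ∀ i → PetersenLink (inj₁ i) (inj₂ i)

petAdj-sym : ∀ u v → petAdj u v ≡ petAdj v u
petAdj-sym = from-yes (all? λ (u : Fin 10) → all? λ (v : Fin 10) → petAdj u v ≟ petAdj v u)

petAdj⇐ : ∀ {x y} → PetersenLink x y → petAdj (join 5 5 x) (join 5 5 y) ≡ true
petAdj⇐ (rim i) = from-yes (all? λ (i : Fin 5) → petAdj (i ↑ˡ 5) (csuc i ↑ˡ 5) ≟ true) i
petAdj⇐ (star i) = from-yes (all? λ (i : Fin 5) → petAdj (5 ↑ʳ i) (5 ↑ʳ csuc (csuc i)) ≟ true) i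
petAdj⇐ (spoke i) = from-yes (all? λ (i : Fin 5) → petAdj (i ↑ˡ 5) (5 ↑ʳ i) ≟ true) i

petAdj⇒ : ∀ x y → petAdj (join 5 5 x) (join 5 5 y) ≡ true → PetersenLink x y ⊎ PetersenLink y x
petAdj⇒ (inj₁ i) (inj₁ j) e = Sum.map (λ { refl → rim i }) (λ { refl → rim j }) (rims i j e)
  where
  rims : ∀ (i j : Fin 5) → petAdj (i ↑ˡ 5) (j ↑ˡ 5) ≡ true → j ≡ csuc i ⊎ i ≡ csuc j
  rims = from-yes (all? λ (i : Fin 5) → all? λ (j : Fin 5) →
    petAdj (i ↑ˡ 5) (j ↑ˡ 5) ≟ true →-dec (j ≟ᶠ csuc i ⊎-dec i ≟ᶠ csuc j))
petAdj⇒ (inj₂ i) (inj₂ j) e = Sum.map (λ { refl → star i }) (λ { refl → star j }) (stars i j e)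
  where
  stars : ∀ (i j : Fin 5) → petAdj (5 ↑ʳ i) (5 ↑ʳ j) ≡ true → j ≡ csuc (csuc i) ⊎ i ≡ csuc (csuc j)
  stars = from-yes (all? λ (i : Fin 5) → all? λ (j : Fin 5) →
    petAdj (5 ↑ʳ i) (5 ↑ʳ j) ≟ true →-dec (j ≟ᶠ csuc (csuc i) ⊎-dec i ≟ᶠ csuc (csuc j)))
petAdj⇒ (inj₁ i) (inj₂ j) e with refl ← from-yes (all? λ (i : Fin 5) → all? λ (j : Fin 5) →
  petAdj (i ↑ˡ 5) (5 ↑ʳ j) ≟ true →-dec i ≟ᶠ j) i j e = inj₁ (spoke i)
petAdj⇒ (inj₂ i) (inj₁ j) e = swap (petAdj⇒ (inj₁ j) (inj₂ i) (trans (petAdj-sym (j ↑ˡ 5) (5 ↑ʳ i)) e))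

spoke-inv : ∀ {k} {q : Fin k → Fin k} {i j} → Link q (inj₁ i) (inj₂ j) → j ≡ q i
spoke-inv (spoke _) = refl

inner-inv : ∀ {k} {q : Fin k → Fin k} {i j} → Link q (inj₂ i) (inj₂ j) → j ≡ csuc i
inner-inv (inner _) = refl

module _ {G : Graph} (P : Permuted G 5) where
  open Permuted P

  -- Let the vertex `q i` of the second cycle carry the label `i` of its partner. In these labels
  -- the second cycle advances by steps of two, in one direction or the other, and so is the
  -- pentagram; `φ` is this relabelling.
  pentagram⇒petersen : (∀ i → q (csuc (csuc i)) ≡ csuc (q i)) ⊎ (∀ i → csuc (q (csuc (csuc i))) ≡ q i) → IsoPetersen G
  pentagram⇒petersen turns = mk↔ₛ′ to from to∘from from∘to , λ u v →
      subst₂ (λ u′ v′ → adj G u′ v′ ≡ petAdj (to u) (to v)) (from∘to u) (from∘to v)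
        (trans (same (splitAt 5 (to u)) (splitAt 5 (to v)))
               (cong₂ petAdj (join-splitAt 5 5 (to u)) (join-splitAt 5 5 (to v))))
    where
    φ : Fin 5 ⊎ Fin 5 → Fin (n G)
    φ x = ψ (map₂ q x)
    to : Fin (n G) → Fin 10
    to v = join 5 5 (map₂ q⁻ (ψ⁻ v))
    from : Fin 10 → Fin (n G)
    from a = φ (splitAt 5 a)
    q⁻∘q-map : ∀ (x : Fin 5 ⊎ Fin 5) → map₂ q⁻ (map₂ q x) ≡ x
    q⁻∘q-map (inj₁ _) = refl
    q⁻∘q-map (inj₂ i) = cong inj₂ (q⁻∘q i)
    q∘q⁻-map : ∀ (x : Fin 5 ⊎ Fin 5) → map₂ q (map₂ q⁻ x) ≡ x
    q∘q⁻-map (inj₁ _) = refl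
    q∘q⁻-map (inj₂ j) = cong inj₂ (q∘q⁻ j)
    to∘from : ∀ a → to (from a) ≡ a
    to∘from a = trans (cong (join 5 5 ∘ map₂ q⁻) (ψ⁻∘ψ _))
                      (trans (cong (join 5 5) (q⁻∘q-map (splitAt 5 a))) (join-splitAt 5 5 a))
    from∘to : ∀ v → from (to v) ≡ v
    from∘to v = trans (cong φ (splitAt-join 5 5 (map₂ q⁻ (ψ⁻ v)))) (trans (cong ψ (q∘q⁻-map (ψ⁻ v))) (ψ∘ψ⁻ v))

    chord : ∀ {i j} → q j ≡ csuc (q i) → PetersenLink (inj₂ i) (inj₂ j) ⊎ PetersenLink (inj₂ j) (inj₂ i)
    chord {i} {j} e = [ (λ f → inj₁ (forwards (q-injective (trans e (sym (f i))))))
                      , (λ f → inj₂ (backwards (q-injective (csuc-injective (trans (f j) e))))) ]′ turns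
      where
      forwards : j ≡ csuc (csuc i) → PetersenLink (inj₂ i) (inj₂ j)
      forwards refl = star i
      backwards : csuc (csuc j) ≡ i → PetersenLink (inj₂ j) (inj₂ i)
      backwards refl = star j

    link : ∀ x y → Link q (map₂ q x) (map₂ q y) → PetersenLink x y ⊎ PetersenLink y x
    link (inj₁ i) (inj₁ _) (outer _) = inj₁ (rim i)
    link (inj₁ i) (inj₂ j) l with refl ← q-injective (spoke-inv l) = inj₁ (spoke i)
    link (inj₂ i) (inj₂ j) l = chord (inner-inv l)

    adj⇐′ : ∀ {x y} → Link q x y → adj G (ψ y) (ψ x) ≡ true
    adj⇐′ l = trans (adj-sym G _ _) (adj⇐ l)

    link⁻ : ∀ {x y} → PetersenLink x y → adj G (φ x) (φ y) ≡ true
    link⁻ (rim i)   = adj⇐ (outer i)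
    link⁻ (spoke i) = adj⇐ (spoke i)
    link⁻ (star i)  = [ (λ f → subst (λ j → adj G (ψ (inj₂ (q i))) (ψ (inj₂ j)) ≡ true) (sym (f i)) (adj⇐ (inner (q i))))
                      , (λ f → subst (λ j → adj G (ψ (inj₂ j)) (ψ (inj₂ (q (csuc (csuc i))))) ≡ true) (f i)
                                     (adj⇐′ (inner (q (csuc (csuc i))))))
                      ]′ turns

    link⇒petAdj : ∀ x y → PetersenLink x y ⊎ PetersenLink y x → petAdj (join 5 5 x) (join 5 5 y) ≡ true
    link⇒petAdj x y (inj₁ l) = petAdj⇐ l
    link⇒petAdj x y (inj₂ l) = trans (petAdj-sym (join 5 5 x) (join 5 5 y)) (petAdj⇐ l)

    same : ∀ x y → adj G (φ x) (φ y) ≡ petAdj (join 5 5 x) (join 5 5 y)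
    same x y = ⇔→≡ (mk⇔
      (λ e → link⇒petAdj x y ([ link x y , swap ∘ link y x ]′ (adj⇒ (map₂ q x) (map₂ q y) e)))
      (λ e → [ link⁻ , (λ l → trans (adj-sym G _ _) (link⁻ l)) ]′ (petAdj⇒ x y e)))

-- Of the two out-neighbours i + 1 and i + 3 of i on a 5-cycle, the second precedes the first.
csuc-of-successors : ∀ {i j l : Fin 5} → i ⟶ j → i ⟶ l → j ⟶ l → l ≡ csuc i
csuc-of-successors {i} {j} {l} = from-yes (all? λ (i : Fin 5) → all? λ (j : Fin 5) → all? λ (l : Fin 5) →
  ⟶? i j →-dec (⟶? i l →-dec (⟶? j l →-dec l ≟ᶠ csuc i))) i j l

-- Graphs without a common cyclic triple

module NoCommonTriangle {G : Graph} (h : ℕ) (h>0 : 0 < h) (P : Permuted G (suc (h * 2))) where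
  open OddCycle h h>0
  open OddPermutation h h>0 P
  open Permuted P

  module _ (none : ¬ CommonTriangle) where

    disjoint⇒ : Disjoint _⇒_
    disjoint⇒ cyc c = none (_ , _ , _ , cyc , inj₁ c)

    disjoint⇐ : Disjoint (flip _⇒_)
    disjoint⇐ cyc c = none (_ , _ , _ , cyc , inj₂ c)

    module Forwards  = Oriented ⇒-locallyTransitive disjoint⇒ disjoint⇐
    module Backwards = Oriented (opposite ⇒-locallyTransitive) disjoint⇐ disjoint⇒

    orientation : vtx 0 ⇒ vtx 1 ⊎ vtx 1 ⇒ vtx 0
    orientation = total ⇒-locallyTransitive (⇒-≢ ⟶-locallyTransitive (⟶-csuc (vtx 0)))

    h<3 : ¬ 3 ≤ h
    h<3 3≤h = [ (λ s → Forwards.h<3 s 3≤h) , (λ s → Backwards.h<3 s 3≤h) ]′ orientation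

    h≢1 : h ≢ 1
    h≢1 h≡1 = [ (λ s → Forwards.h≢1 s h≡1) , (λ s → Backwards.h≢1 s h≡1) ]′ orientation

-- In the forward case `q` sends consecutive vertices to a vertex and its two out-neighbours, the
-- first of which dominates the second; so the second is the cyclic successor. In the backward case
-- the same is read from the last of the three vertices.
pentagon⇒petersen : ∀ {G} (h>0 : 0 < 2) (P : Permuted G 5) →
                    ¬ OddPermutation.CommonTriangle 2 h>0 P → IsoPetersen G
pentagon⇒petersen h>0 P none = pentagram⇒petersen P (Sum.map forwards backwards (orientation none))
  where
  open Permuted P
  open OddCycle 2 h>0
  open OddPermutation 2 h>0 P
  open NoCommonTriangle 2 h>0 P
  everywhere : (A : Fin 5 → Set) → (∀ m → A (vtx m)) → ∀ i → A i
  everywhere A f i = subst A (vtx-toℕ i) (f (toℕ i))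
  forwards : vtx 0 ⇒ vtx 1 → ∀ i → q (csuc (csuc i)) ≡ csuc (q i)
  forwards s = everywhere (λ i → q (csuc (csuc i)) ≡ csuc (q i)) λ m →
    csuc-of-successors (Forwards.step₁ none s m) (Forwards.step₂ none s m) (Forwards.step₁ none s (1 + m))
  backwards : vtx 1 ⇒ vtx 0 → ∀ i → csuc (q (csuc (csuc i))) ≡ q i
  backwards s = everywhere (λ i → csuc (q (csuc (csuc i))) ≡ q i) λ m →
    sym (csuc-of-successors (Backwards.step₁ none s (1 + m)) (Backwards.step₂ none s m) (Backwards.step₁ none s m))

noCommonTriangle⇒petersen : ∀ {G} h (h>0 : 0 < h) (P : Permuted G (suc (h * 2))) →
                                ¬ OddPermutation.CommonTriangle h h>0 P → IsoPetersen G
noCommonTriangle⇒petersen 1 h>0 P none = ⊥-elim (NoCommonTriangle.h≢1 1 h>0 P none refl)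
noCommonTriangle⇒petersen 2 h>0 P none = pentagon⇒petersen h>0 P none
noCommonTriangle⇒petersen (suc (suc (suc _))) h>0 P none =
  ⊥-elim (NoCommonTriangle.h<3 _ h>0 P none (s≤s (s≤s (s≤s z≤n))))

odd⇒τ≤4⊎petersen : ∀ {G} h → 0 < h → Permuted G (suc (h * 2)) → τ≤ G 4 ⊎ IsoPetersen G
odd⇒τ≤4⊎petersen h h>0 P with OddPermutation.commonTriangle? h h>0 P
... | yes (_ , _ , _ , cyc , cycᵒ) = inj₁ (OddPermutation.commonTriangle⇒τ≤4 h h>0 P cyc cycᵒ)
... | no none                      = inj₂ (noCommonTriangle⇒petersen h h>0 P none)

-- The two parities of the cycle length

even-csuc : ∀ {k} → even k ≡ true → ∀ (i : Fin k) → even (toℕ (csuc i)) ≡ not (even (toℕ i))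
even-csuc {suc m} k-even i with csuc-cases i
... | inj₁ (e , _)   = cong even e
... | inj₂ (e , i≡m) = trans (cong (even ∘ toℕ) e) (sym (trans (cong (not ∘ even) i≡m) k-even))

odd-form : ∀ k → even k ≡ false → ∃ λ h → k ≡ suc (h * 2)
odd-form 1 _ = 0 , refl
odd-form (suc (suc k)) e with odd-form k (trans (sym (not-involutive _)) e)
... | h , refl = suc h , refl

permuted⇒τ≤4⊎petersen : ∀ {G k} → 3 ≤ k → Permuted G k → τ≤ G 4 ⊎ IsoPetersen G
permuted⇒τ≤4⊎petersen {k = k} 3≤k P with even k in parity
... | true = inj₁ (bipartite⇒τ≤4 P (even ∘ toℕ) (even-csuc parity))
... | false with odd-form k parity
...   | zero  , refl with s≤s () ← 3≤k
...   | suc h , refl = odd⇒τ≤4⊎petersen (suc h) (s≤s z≤n) P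

theorem3p12 : (G : Graph) → PermutationGraph G → τ≤ G 4 ⊎ IsoPetersen G
theorem3p12 G permutation =
  let (_ , 3≤k , P) = permutationGraph⇒permuted permutation in permuted⇒τ≤4⊎petersen 3≤k P
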